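{- For all integers $k \ge 2$ it holds that $$S'_2(k) = \sum_{j=1}^2 S'_2(i_S(k-j)) = S'_2(i_S(k-1)) + S'_2(i_S(k-2)).$$
   Context: The sequence $S'_2 : \mathbb{N}_0 \to \mathbb{N}_0$ (with $\mathbb{N}_0 = \{0,1,2,\dots\}$) is defined recursively: $S'_2(0) := 0$, $S'_2(1) := 2$, and for $k \ge 2$, $S'_2(k) := 2 \cdot (k-i+1)$ for the minimal $i \in \{1,\dots,k-1\}$ with $k-i+1 \le S'_2(i)$ (such an $i$ always exists). For $k \ge 0$ the index is defined by $i_S(k) := k + 1 - \frac{S'_2(k)}{2} \in \mathbb{N} = \{1,2,\dots\}$. -}

module Defs where

open import Data.Bool.Base using (if_then_else_)
open import Data.Nat.Base
open import Data.Nat.Properties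
open import Data.Nat.DivMod using (_/_; m*n/n≡m)
open import Data.Nat.Divisibility using (_∣_; m∣m*n; _∣0; ∣-refl)
open import Data.Product.Base using (∃; _×_; _,_)
open import Data.Sum.Base using (inj₁; inj₂)
open import Level using (0ℓ)
open import Relation.Nullary using (yes; no; does; contradiction)
open import Relation.Unary using (Pred; Decidable)
open import Relation.Binary.PropositionalEquality

-- The least i in {lo, …, lo + m} satisfying P.  If none of the candidates
-- before the last one satisfies P, the last one is returned untested.
leastFrom : {P : Pred ℕ 0ℓ} → Decidable P → (lo m : ℕ) → ℕ
leastFrom P? lo zero    = lo
leastFrom P? lo (suc m) = if does (P? lo) then lo else leastFrom P? (suc lo) m

-- The minimal i ∈ {1, …, k - 1} with k - i + 1 ≤ f i, for k ≥ 2.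
minIndex : (ℕ → ℕ) → ℕ → ℕ
minIndex f k = leastFrom (λ i → k ∸ i + 1 ≤? f i) 1 (k ∸ 2)

step : (ℕ → ℕ) → ℕ → ℕ
step f 0 = 0
step f 1 = 2
step f k@(suc (suc _)) = 2 * (k ∸ minIndex f k + 1)

-- Course-of-values recursion: approx n agrees with the sequence below n.
approx : ℕ → ℕ → ℕ
approx zero    _ = 0
approx (suc n) k = step (approx n) k

-- The sequence S'₂; `S′₂-rec` below is its defining recursion, including the
-- existence of the minimal i, so the untested default in `leastFrom` is harmless.
S′₂ : ℕ → ℕ
S′₂ k = approx (suc k) k

-- `S′₂-even` and `index-positive` below show that neither the division nor
-- the subtraction truncates.
iS : ℕ → ℕ
iS k = k + 1 ∸ S′₂ k / 2

IsMinIndex : (ℕ → ℕ) → ℕ → ℕ → Set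
IsMinIndex f k i =
  (1 ≤ i × i ≤ k ∸ 1) × k ∸ i + 1 ≤ f i ×
  (∀ j → 1 ≤ j → j ≤ k ∸ 1 → k ∸ j + 1 ≤ f j → i ≤ j)

private

  leastFrom-cong : ∀ (f g : ℕ → ℕ) k lo m → (∀ i → i < lo + m → f i ≡ g i) →
    leastFrom (λ i → k ∸ i + 1 ≤? f i) lo m ≡ leastFrom (λ i → k ∸ i + 1 ≤? g i) lo m
  leastFrom-cong f g k lo zero    eq = refl
  leastFrom-cong f g k lo (suc m) eq
    rewrite eq lo (m<m+n lo z<s)
          | leastFrom-cong f g k (suc lo) m (λ i i< → eq i (subst (i <_) (sym (+-suc lo m)) i<))
    = refl

  step-cong : ∀ (f g : ℕ → ℕ) k → (∀ i → i < k → f i ≡ g i) → step f k ≡ step g k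
  step-cong f g 0             eq = refl
  step-cong f g 1             eq = refl
  step-cong f g (suc (suc k)) eq =
    cong (λ i → 2 * (suc (suc k) ∸ i + 1))
      (leastFrom-cong f g (suc (suc k)) 1 k (λ i i< → eq i (m<n⇒m<1+n i<)))

  approx-stable : ∀ m n k → k < m → k < n → approx m k ≡ approx n k
  approx-stable (suc m) (suc n) k (s≤s k≤m) (s≤s k≤n) =
    step-cong (approx m) (approx n) k
      (λ i i<k → approx-stable m n i (<-≤-trans i<k k≤m) (<-≤-trans i<k k≤n))

  S′₂-step : ∀ k → S′₂ k ≡ step S′₂ k
  S′₂-step k = step-cong (approx k) S′₂ k (λ i i<k → approx-stable k (suc i) i i<k ≤-refl)

  leastFrom-least : {P : Pred ℕ 0ℓ} (P? : Decidable P) → ∀ lo m → P (lo + m) →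
    let i = leastFrom P? lo m in
    (lo ≤ i × i ≤ lo + m) × P i × (∀ j → lo ≤ j → P j → i ≤ j)
  leastFrom-least {P} P? lo zero p =
    (≤-refl , m≤m+n lo 0) , subst P (+-identityʳ lo) p , λ _ lo≤j _ → lo≤j
  leastFrom-least {P} P? lo (suc m) p with P? lo
  ... | yes q = (≤-refl , m≤m+n lo (suc m)) , q , λ _ lo≤j _ → lo≤j
  ... | no ¬q with leastFrom-least P? (suc lo) m (subst P (+-suc lo m) p)
  ...   | (l , u) , q , least =
    (<⇒≤ l , subst (leastFrom P? (suc lo) m ≤_) (sym (+-suc lo m)) u) , q , least′
    where
    least′ : ∀ j → lo ≤ j → P j → leastFrom P? (suc lo) m ≤ j
    least′ j lo≤j pj with m≤n⇒m<n∨m≡n lo≤j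
    ... | inj₁ lo<j = least j lo<j pj
    ... | inj₂ refl = contradiction pj ¬q

  S′₂≥2 : ∀ k → 1 ≤ k → 2 ≤ S′₂ k
  S′₂≥2 1             _ = ≤-refl
  S′₂≥2 (suc (suc k)) _ = *-monoʳ-≤ 2
    (m≤n+m 1 (suc (suc k) ∸ minIndex (approx (suc (suc k))) (suc (suc k))))

  last-works : ∀ k → suc (suc k) ∸ suc k + 1 ≤ S′₂ (suc k)
  last-works k = subst (λ d → d + 1 ≤ S′₂ (suc k)) (sym (m+n∸n≡m 1 (suc k)))
                   (S′₂≥2 (suc k) (s≤s z≤n))

S′₂-0 : S′₂ 0 ≡ 0
S′₂-0 = refl

S′₂-1 : S′₂ 1 ≡ 2
S′₂-1 = refl

S′₂-rec : ∀ k → 2 ≤ k → ∃ λ i → IsMinIndex S′₂ k i × S′₂ k ≡ 2 * (k ∸ i + 1)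
S′₂-rec 1 (s≤s ())
S′₂-rec (suc (suc k)) _
  with leastFrom-least (λ i → suc (suc k) ∸ i + 1 ≤? S′₂ i) 1 k (last-works k)
... | bounds , q , least =
  minIndex S′₂ (suc (suc k)) ,
  (bounds , q , λ j 1≤j _ → least j 1≤j) ,
  S′₂-step (suc (suc k))

S′₂-even : ∀ k → 2 ∣ S′₂ k
S′₂-even 0             = 2 ∣0
S′₂-even 1             = ∣-refl
S′₂-even (suc (suc k)) =
  m∣m*n (suc (suc k) ∸ minIndex (approx (suc (suc k))) (suc (suc k)) + 1)

index-positive : ∀ k → S′₂ k / 2 < k + 1
index-positive 0 = s≤s z≤n
index-positive 1 = s≤s (s≤s z≤n)
index-positive k@(suc (suc k′)) with S′₂-rec k (s≤s (s≤s z≤n))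
... | i , ((1≤i , _) , _) , eq = begin-strict
  S′₂ k / 2              ≡⟨ cong (_/ 2) (trans eq (*-comm 2 (k ∸ i + 1))) ⟩
  (k ∸ i + 1) * 2 / 2    ≡⟨ m*n/n≡m (k ∸ i + 1) 2 ⟩
  k ∸ i + 1              <⟨ +-monoˡ-< 1 (s≤s (∸-monoʳ-≤ k 1≤i)) ⟩
  k + 1                  ∎
  where open ≤-Reasoning

{-# OPTIONS --safe #-}

-- Put h n = n + S′₂ n. The defining minimality says that the index of k is
-- n + 1 exactly when h n ≤ k < h (n + 1), and then S′₂ k = 2 (k - n). Hence S′₂
-- grows by 0 or 2 at each step, so ℕ is cut into blocks [h n, h (n + 1)) of length
-- 1 or 3, and at k = h n + j the value is S′₂ k = 2 (S′₂ n + j). The recurrence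
-- follows by locating k - 1 and k - 2, for each j ∈ {0, 1, 2}, in the blocks.
module Submission where

open import Data.Nat.Base using (ℕ; _+_; _∸_; _≤_)
open import Data.List.Base using (sum; map; _∷_; [])
open import Data.Product.Base using (_×_)
open import Relation.Binary.PropositionalEquality using (_≡_)
open import Defs

open import Data.Nat.Base using (zero; suc; _*_; _<_; z≤n; s≤s; s≤s⁻¹; z<s)
open import Data.Nat.DivMod using (_/_; m*n/n≡m)
open import Data.Nat.Properties
open import Data.Nat.Tactic.RingSolver using (solve-∀)
open import Data.Product.Base using (∃; _,_)
open import Data.Sum.Base using (_⊎_; inj₁; inj₂)
open import Relation.Nullary using (contradiction)
open import Relation.Binary.PropositionalEquality
  using (refl; sym; trans; cong; cong₂; subst; module ≡-Reasoning)

-- Blocks, and the index read off from minimality.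

h : ℕ → ℕ
h n = n + S′₂ n

record InBlock (k n : ℕ) : Set where
  no-eta-equality
  pattern
  constructor _,_
  field
    lower : h n ≤ k
    upper : k < h (suc n)

-- `value` is additive to avoid truncated subtraction; `bound` keeps the block within reach of the
-- later induction on `SmallStep`.
record Located (k n : ℕ) : Set where
  field
    index-suc : iS k ≡ suc n
    value     : S′₂ k + 2 * n ≡ 2 * k
    block     : InBlock k n
    bound     : n ≤ k ∸ 1

located-≥2 : ∀ k n → let K = suc (suc k) in
  IsMinIndex S′₂ K (suc n) → S′₂ K ≡ 2 * (K ∸ suc n + 1) → Located K n
located-≥2 k n ((_ , 1+n≤1+k) , works , least) eq = record
  { index-suc = begin
      K + 1 ∸ S′₂ K / 2        ≡⟨ cong (λ s → K + 1 ∸ s / 2) (trans S≡ (*-comm 2 (K ∸ n))) ⟩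
      K + 1 ∸ (K ∸ n) * 2 / 2  ≡⟨ cong (K + 1 ∸_) (m*n/n≡m (K ∸ n) 2) ⟩
      K + 1 ∸ (K ∸ n)          ≡⟨ cong (_∸ (K ∸ n)) (+-comm K 1) ⟩
      suc K ∸ (K ∸ n)          ≡⟨ +-∸-assoc 1 (m∸n≤m K n) ⟩
      suc (K ∸ (K ∸ n))        ≡⟨ cong suc (m∸[m∸n]≡n n≤K) ⟩
      suc n                    ∎
  ; value = begin
      S′₂ K + 2 * n            ≡⟨ cong (_+ 2 * n) S≡ ⟩
      2 * (K ∸ n) + 2 * n      ≡⟨ sym (*-distribˡ-+ 2 (K ∸ n) n) ⟩
      2 * (K ∸ n + n)          ≡⟨ cong (2 *_) (m∸n+n≡m n≤K) ⟩
      2 * K                    ∎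
  ; block = lower n n≤k least , upper
  ; bound = m≤n⇒m≤1+n n≤k
  }
  where
  open ≡-Reasoning
  K = suc (suc k)
  n≤k = s≤s⁻¹ 1+n≤1+k
  n≤K = m≤n⇒m≤1+n (m≤n⇒m≤1+n n≤k)

  gap : K ∸ suc n + 1 ≡ K ∸ n
  gap = trans (+-comm (suc k ∸ n) 1) (sym (+-∸-assoc 1 (m≤n⇒m≤1+n n≤k)))

  S≡ : S′₂ K ≡ 2 * (K ∸ n)
  S≡ = trans eq (cong (2 *_) gap)

  -- The inequality satisfied by `suc n` reads `K ∸ n ≤ S′₂ (suc n)`; adding `n` gives the upper
  -- end.
  upper : K < h (suc n)
  upper = s≤s (subst (_≤ n + S′₂ (suc n)) (m+[n∸m]≡n n≤K)
            (+-monoʳ-≤ n (subst (_≤ S′₂ (suc n)) gap works)))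

  -- If `K < h n` with `n` positive, then `n` would satisfy the inequality too, against the
  -- minimality of `suc n`. The value 0 is no candidate, but `h 0` is 0.
  lower : ∀ n → n ≤ k →
    (∀ j → 1 ≤ j → j ≤ suc k → K ∸ j + 1 ≤ S′₂ j → suc n ≤ j) → h n ≤ K
  lower zero    _   _     = z≤n
  lower (suc p) p<k least = ≮⇒≥ λ K<h →
    1+n≰n (least (suc p) (s≤s z≤n) (m≤n⇒m≤1+n p<k)
      (+-cancelˡ-≤ (suc p) _ _ (subst (_≤ h (suc p)) (sym total) K<h)))
    where
    total : suc p + (K ∸ suc p + 1) ≡ suc K
    total = trans (sym (+-assoc (suc p) (K ∸ suc p) 1))
      (trans (cong (_+ 1) (m+[n∸m]≡n (m≤n⇒m≤1+n (m≤n⇒m≤1+n p<k)))) (+-comm K 1))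

located : ∀ k → ∃ (Located k)
located 0 = 0 , record { index-suc = refl ; value = refl ; block = z≤n , z<s ; bound = z≤n }
located 1 = 0 , record
  { index-suc = refl ; value = refl ; block = z≤n , s≤s (s≤s z≤n) ; bound = z≤n }
located (suc (suc k)) with S′₂-rec (suc (suc k)) (s≤s (s≤s z≤n))
... | suc n , min , eq = n , located-≥2 k n min eq
... | zero , ((() , _) , _) , _

-- Increments of the sequence are 0 or 2.

data SmallStep (k : ℕ) : Set where
  flat : S′₂ (suc k) ≡ S′₂ k     → SmallStep k
  jump : S′₂ (suc k) ≡ 2 + S′₂ k → SmallStep k

small-step-mono : ∀ {k} → SmallStep k → S′₂ k ≤ S′₂ (suc k)
small-step-mono (flat eq) = ≤-reflexive (sym eq)
small-step-mono (jump eq) = ≤-trans (m≤n+m _ 2) (≤-reflexive (sym eq))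

h-step : ∀ {k} → SmallStep k → h k < h (suc k)
h-step {k} st = s≤s (+-monoʳ-≤ k (small-step-mono st))

-- Limited to arguments up to `b` because it serves inside the induction that establishes
-- `SmallStep`.
h-mono-below : ∀ b → (∀ p → p < b → SmallStep p) → ∀ {m n} → m ≤ n → n ≤ b → h m ≤ h n
h-mono-below b st {m} {zero}  z≤n _ = ≤-refl
h-mono-below b st {m} {suc n} m≤1+n n<b with m≤n⇒m<n∨m≡n m≤1+n
... | inj₁ m<1+n = ≤-trans (h-mono-below b st (s≤s⁻¹ m<1+n) (<⇒≤ n<b)) (<⇒≤ (h-step (st n n<b)))
... | inj₂ refl  = ≤-refl

-- If `m < n`, then `suc k < h (suc m) ≤ h n ≤ k`. If `suc n < m`, then `h (suc n) < h m ≤ suc k`,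
-- against `k < h (suc n)`. By `bound`, only steps below `k` are used.
next-block : ∀ k → (∀ p → p < k → SmallStep p) → ∀ {n m} →
  Located k n → Located (suc k) m → m ≡ n ⊎ m ≡ suc n
next-block k st {n} {m} L M with m≤n⇒m<n∨m≡n n≤m
  where
  n≤m : n ≤ m
  n≤m = ≮⇒≥ λ m<n → <-irrefl refl (<-≤-trans
    (<-trans (n<1+n k) (InBlock.upper (Located.block M)))
    (≤-trans (h-mono-below k st m<n (≤-trans (Located.bound L) (m∸n≤m k 1)))
             (InBlock.lower (Located.block L))))
... | inj₂ refl = inj₁ refl
... | inj₁ n<m with m≤n⇒m<n∨m≡n n<m
...   | inj₂ refl   = inj₂ refl
...   | inj₁ 1+n<m = contradiction
  (≤-trans (h-mono-below k st 1+n<m (Located.bound M)) (InBlock.lower (Located.block M)))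
  (<⇒≱ (≤-<-trans (InBlock.upper (Located.block L))
    (h-step (st (suc n) (<-≤-trans 1+n<m (Located.bound M))))))

-- Compare the two `value` equations: the increment is 2 if the block stays the same and 0 if it
-- advances.
small-step-from : ∀ k → (∀ p → p < k → SmallStep p) → SmallStep k
small-step-from k st with located k | located (suc k)
... | n , L | m , M with next-block k st L M
...   | inj₁ refl = jump (+-cancelʳ-≡ (2 * n) _ _ (begin
  S′₂ (suc k) + 2 * n  ≡⟨ Located.value M ⟩
  2 * suc k            ≡⟨ *-suc 2 k ⟩
  2 + 2 * k            ≡⟨ cong (2 +_) (sym (Located.value L)) ⟩
  2 + S′₂ k + 2 * n    ∎))
  where open ≡-Reasoning
...   | inj₂ refl = flat (+-cancelʳ-≡ (2 * suc n) _ _ (begin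
  S′₂ (suc k) + 2 * suc n  ≡⟨ Located.value M ⟩
  2 * suc k                ≡⟨ *-suc 2 k ⟩
  2 + 2 * k                ≡⟨ cong (2 +_) (sym (Located.value L)) ⟩
  2 + (S′₂ k + 2 * n)      ≡⟨ shift (S′₂ k) n ⟩
  S′₂ k + 2 * suc n        ∎))
  where
  open ≡-Reasoning
  shift : ∀ s n → 2 + (s + 2 * n) ≡ s + 2 * suc n
  shift = solve-∀

small-step-below : ∀ k p → p < k → SmallStep p
small-step-below (suc k) p p<1+k with m≤n⇒m<n∨m≡n (s≤s⁻¹ p<1+k)
... | inj₁ p<k  = small-step-below k p p<k
... | inj₂ refl = small-step-from k (small-step-below k)

small-step : ∀ k → SmallStep k
small-step k = small-step-below (suc k) k ≤-refl

-- Uniqueness of blocks and the values inside them.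

h-mono : ∀ {m n} → m ≤ n → h m ≤ h n
h-mono {n = n} m≤n = h-mono-below n (λ p _ → small-step p) m≤n ≤-refl

block-≤ : ∀ {k m n} → InBlock k m → InBlock k n → m ≤ n
block-≤ (hm≤k , _) (_ , k<h) = ≮⇒≥ λ n<m → <⇒≱ k<h (≤-trans (h-mono n<m) hm≤k)

-- Blocks are disjoint, so exhibiting any block that contains `k` determines its index and value.
located-at : ∀ {k n} → InBlock k n → Located k n
located-at {k} {n} B with located k
... | m , L = subst (Located k)
  (≤-antisym (block-≤ (Located.block L) B) (block-≤ B (Located.block L))) L

index-at : ∀ {k n} → InBlock k n → iS k ≡ suc n
index-at B = Located.index-suc (located-at B)

value-at : ∀ {k n} j → InBlock k n → h n + j ≡ k → S′₂ k ≡ 2 * (S′₂ n + j)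
value-at {n = n} j B refl = +-cancelʳ-≡ (2 * n) _ _
  (trans (Located.value (located-at B)) (shift n (S′₂ n) j))
  where
  shift : ∀ n s j → 2 * (n + s + j) ≡ 2 * (s + j) + 2 * n
  shift = solve-∀

h-flat : ∀ n → S′₂ (suc n) ≡ S′₂ n → h (suc n) ≡ 1 + h n
h-flat n eq = cong (suc n +_) eq

h-jump : ∀ n → S′₂ (suc n) ≡ 2 + S′₂ n → h (suc n) ≡ 3 + h n
h-jump n eq = trans (cong (suc n +_) eq) (shift n (S′₂ n))
  where
  shift : ∀ n s → suc n + (2 + s) ≡ 3 + (n + s)
  shift = solve-∀

jump-block : ∀ {k} n j → j ≤ 2 → S′₂ (suc n) ≡ 2 + S′₂ n → h n + j ≡ k → InBlock k n
jump-block n j j≤2 jp refl = m≤m+n (h n) j ,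
  subst (h n + j <_) (sym (h-jump n jp))
    (s≤s (≤-trans (+-monoʳ-≤ (h n) j≤2) (≤-reflexive (+-comm (h n) 2))))

-- `h` increases strictly, so the predecessor of a block start cannot fall below the previous block.
last-in-block : ∀ {k} n → suc k ≡ h (suc n) → InBlock k n
last-in-block n eq =
  s≤s⁻¹ (subst (h n <_) (sym eq) (h-step (small-step n))) , ≤-reflexive eq

-- The recurrence, by position in the block.

data Position (k n : ℕ) : Set where
  first  : h n ≡ k → Position k n
  second : h n + 1 ≡ k → S′₂ (suc n) ≡ 2 + S′₂ n → Position k n
  third  : h n + 2 ≡ k → S′₂ (suc n) ≡ 2 + S′₂ n → Position k n

-- A flat step makes the block have length 1, a jump length 3; any larger offset would violate `up`.
position : ∀ {k n} → InBlock k n → Position k n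
position {k} {n} (lo , up) = go (k ∸ h n) (m+[n∸m]≡n lo) (small-step n)
  where
  go : ∀ j → h n + j ≡ k → SmallStep n → Position k n
  go 0 eq _         = first (trans (sym (+-identityʳ _)) eq)
  go 1 eq (jump jp) = second eq jp
  go 2 eq (jump jp) = third eq jp
  go (suc j) eq (flat fl) = contradiction
    (subst (k <_) (h-flat n fl) up)
    (≤⇒≯ (subst (suc (h n) ≤_) (trans (sym (+-suc (h n) j)) eq) (s≤s (m≤m+n (h n) j))))
  go (suc (suc (suc j))) eq (jump jp) = contradiction
    (subst (k <_) (h-jump n jp) up)
    (≤⇒≯ (subst (3 + h n ≤_) (trans (+-comm (3 + j) (h n)) eq)
      (s≤s (s≤s (s≤s (m≤n+m (h n) j))))))

Recurrence : ℕ → Set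
Recurrence k = S′₂ (suc (suc k)) ≡ S′₂ (iS (suc k)) + S′₂ (iS k)

recurrence-from : ∀ {k m p} → InBlock (suc k) m → InBlock k p →
  S′₂ (suc (suc k)) ≡ S′₂ (suc m) + S′₂ (suc p) → Recurrence k
recurrence-from B C eq =
  trans eq (sym (cong₂ (λ a b → S′₂ a + S′₂ b) (index-at B) (index-at C)))

double : ∀ s → 2 * (s + 0) ≡ s + s
double = solve-∀

recurrence-at : ∀ k n → InBlock (suc (suc k)) n → Position (suc (suc k)) n → Recurrence k
-- Both predecessors lie in block `n`, so both terms are `S′₂ (suc n)`.
recurrence-at k n B (third eq jp) = recurrence-from
  (jump-block n 1 (s≤s z≤n) jp (suc-injective (trans (sym (+-suc (h n) 1)) eq)))
  (jump-block n 0 z≤n jp (suc-injective (suc-injective (trans (shift (h n)) eq))))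
  (trans (value-at 2 B eq) (trans (twice (S′₂ n)) (cong₂ _+_ (sym jp) (sym jp))))
  where
  shift : ∀ a → 2 + (a + 0) ≡ a + 2
  shift = solve-∀
  twice : ∀ s → 2 * (s + 2) ≡ (2 + s) + (2 + s)
  twice = solve-∀
-- Offset 1 in block 0 is the number 1, too small. Otherwise `suc k` starts block `suc m` and `k`
-- ends block `m`.
recurrence-at k zero B (second () _)
recurrence-at k (suc m) B (second eq jp) = recurrence-from
  (jump-block (suc m) 0 z≤n jp (trans (+-identityʳ _) eq′))
  (last-in-block m (sym eq′))
  (trans (value-at 1 B eq) (trans (twice (S′₂ (suc m))) (cong (_+ S′₂ (suc m)) (sym jp))))
  where
  eq′ : h (suc m) ≡ suc k
  eq′ = suc-injective (trans (+-comm 1 _) eq)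
  twice : ∀ s → 2 * (s + 1) ≡ (2 + s) + s
  twice = solve-∀
-- Here `suc k` ends block `m` and supplies half of `2 * S′₂ (suc m)`. After a jump `k` shares block
-- `m` and supplies the other half.
recurrence-at k zero    B (first ())
recurrence-at k (suc m) B (first eq) = by-step (small-step m)
  where
  C : InBlock (suc k) m
  C = last-in-block m (sym eq)
  S≡ : S′₂ (suc (suc k)) ≡ S′₂ (suc m) + S′₂ (suc m)
  S≡ = trans (value-at 0 B (trans (+-identityʳ _) eq)) (double (S′₂ (suc m)))
  -- A block `m` of length 1 leaves `k` at the end of the block before it, and flatness makes its
  -- term equal. Block 0 is not flat: the values at 0 and 1 are 0 and 2.
  below-flat : ∀ m → S′₂ (suc m) ≡ S′₂ m → h (suc m) ≡ suc (suc k) →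
    ∃ λ p → InBlock k p × S′₂ (suc p) ≡ S′₂ (suc m)
  below-flat zero    ()
  below-flat (suc p) fl eq =
    p , last-in-block p (suc-injective (trans (sym eq) (h-flat (suc p) fl))) , sym fl
  by-step : SmallStep m → Recurrence k
  by-step (jump jp) = recurrence-from C
    (jump-block m 1 (s≤s z≤n) jp
      (trans (+-comm (h m) 1)
        (suc-injective (suc-injective (trans (sym (h-jump m jp)) eq)))))
    S≡
  by-step (flat fl) with below-flat m fl eq
  ... | p , D , S≡′ = recurrence-from C D (trans S≡ (cong (S′₂ (suc m) +_) (sym S≡′)))

theorem4p15 : ∀ (k : ℕ) → 2 ≤ k →
    (S′₂ k ≡ sum (map (λ j → S′₂ (iS (k ∸ j))) (1 ∷ 2 ∷ [])))
    × (S′₂ k ≡ S′₂ (iS (k ∸ 1)) + S′₂ (iS (k ∸ 2)))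
theorem4p15 1 (s≤s ())
theorem4p15 (suc (suc k)) _ =
  trans eq (cong (S′₂ (iS (suc k)) +_) (sym (+-identityʳ _))) , eq
  where
  eq : Recurrence k
  eq = let n , L = located (suc (suc k)); B = Located.block L in
    recurrence-at k n B (position B)
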